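{- Assume $\Diamond(E^{\mathfrak c}_\omega)$ and $\mathfrak p=\mathfrak c$. Then there exists a nonprincipal ultrafilter $\mathcal U$ on $\omega$ such that $\mathcal U$ is not a P-point and $$\mathfrak c<_T\langle\mathcal U,\supseteq^*\rangle\leq_T\langle\mathcal U,\supseteq\rangle<_T\langle[\mathfrak c]^{<\omega},\subseteq\rangle .$$
   Context: A quasiorder is a set with a reflexive transitive relation $\leq$. A quasiorder is $\kappa$-directed if every subset of size less than $\kappa$ has an upper bound in it; directed means $\omega$-directed. For directed sets $P,Q$, a map $f\colon P\to Q$ is Tukey if the $f$-image of every unbounded subset of $P$ is unbounded in $Q$; $P\leq_T Q$ means a Tukey map $P\to Q$ exists; $P\equiv_T Q$ means $P\leq_T Q\leq_T P$; $P<_T Q$ means $P\leq_T Q$ and $Q\not\leq_T P$. $A\supseteq^* B$ means $B\setminus A$ is finite. $\langle\mathcal U,\supseteq\rangle$ and $\langle\mathcal U,\supseteq^*\rangle$ denote $\mathcal U$ quasiordered so that $A\leq B$ iff $A\supseteq B$, respectively $A\supseteq^* B$. $\mathcal U$ is a P-point if $\langle\mathcal U,\supseteq^*\rangle$ is $\omega_1$-directed. $\mathfrak c=2^{\aleph_0}$; as a directed set $\mathfrak c$ is ordered as an ordinal. $[\mathfrak c]^{<\omega}$ is the set of finite subsets of $\mathfrak c$, ordered by $\subseteq$. A family $\mathcal A\subseteq\mathcal P(\omega)$ has the strong finite intersection property (SFIP) if $\bigcap\sigma$ is infinite for every finite $\sigma\subseteq\mathcal A$. A nontrivial pseudointersection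 of $\mathcal A$ is an infinite $b\subseteq\omega$ with $b\setminus a$ finite for all $a\in\mathcal A$. $\mathfrak p$ is the least cardinality of a family of infinite subsets of $\omega$ that has the SFIP but has no nontrivial pseudointersection. $E^\kappa_\lambda=\{\alpha<\kappa:\operatorname{cf}(\alpha)=\lambda\}$. For a stationary $S\subseteq\kappa$ ($\kappa$ regular uncountable), $\Diamond(S)$ is the assertion that there is a sequence $\langle\Xi_\alpha\rangle_{\alpha\in S}$ with $\Xi_\alpha\subseteq\alpha$ such that for every $X\subseteq\kappa$ the set $\{\alpha\in S: X\cap\alpha=\Xi_\alpha\}$ is stationary in $\kappa$. (Here $\mathfrak p=\mathfrak c$ implies $\mathfrak c$ is regular.) -}

module Defs where

open import Data.Bool using (Bool; true; false; not; _∧_; T)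
open import Data.Bool.Properties using (T?)
open import Data.List using (List; []; _++_)
import Data.List.Membership.Propositional as List
open import Data.List.Membership.Propositional.Properties using (∈-++⁺ˡ; ∈-++⁺ʳ)
open import Data.Nat using (ℕ)
open import Data.Product using (∃; _×_; _,_)
open import Data.Sum using (_⊎_)
open import Function using (_∘_; id; const)
open import Function.Bundles using (_↣_; _⤖_; _⇔_)
open import Function.Definitions using (Injective)
open import Induction.WellFounded using (WellFounded)
open import Level using (0ℓ)
open import Relation.Binary.Bundles using (Preorder)
open import Relation.Binary.Core using (Rel)
import Relation.Binary.Construct.StrictToNonStrict as StrictToNonStrict
open import Relation.Binary.PropositionalEquality
  using (_≡_; refl; isEquivalence)
open import Relation.Binary.Structures using (IsStrictTotalOrder)
open import Relation.Nullary using (¬_; yes; no; contradiction)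
open import Relation.Unary using (Pred; _∈_; _∉_; _⊆_; _≐_; _∩_; _∖_)

-- The development is meant to be read under the hypotheses ExcludedMiddle 0ℓ
-- and Extensionality 0ℓ 0ℓ.  Excluded middle for all (not only
-- proof-irrelevant) types in Set includes the choice principles of ZFC, and it
-- makes characteristic functions X → Bool represent all subsets of X;
-- extensionality identifies functions representing the same subset.  So 𝒫 X
-- below is the full power set.  Collections given by a defining property are
-- written as Pred.

𝒫 : Set → Set
𝒫 X = X → Bool

⟦_⟧ : {X : Set} → 𝒫 X → Pred X 0ℓ
⟦ A ⟧ x = T (A x)

Finite : {X : Set} → Pred X 0ℓ → Set
Finite {X} S = ∃ λ (xs : List X) → S ⊆ (List._∈ xs)

Infinite : {X : Set} → Pred X 0ℓ → Set
Infinite S = ¬ Finite S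

-- Cardinals are represented by types: ∃ ⟦ S ⟧ is the set of elements of S
-- (membership in ⟦ S ⟧ is proof-irrelevant), ↣ is ≤ and ⤖ is equality of
-- cardinals.

_IsLeastCardinalityIn_ : {X : Set} → Set → Pred (𝒫 X) 0ℓ → Set
K IsLeastCardinalityIn 𝔉 =
  (∃ λ S → S ∈ 𝔉 × (∃ ⟦ S ⟧ ⤖ K)) × (∀ S → S ∈ 𝔉 → K ↣ ∃ ⟦ S ⟧)

Quasiorder : Set₁
Quasiorder = Preorder 0ℓ 0ℓ 0ℓ

module _ (P : Quasiorder) where
  open Preorder P

  _IsUpperBoundOf_ : Carrier → Pred Carrier 0ℓ → Set
  b IsUpperBoundOf S = ∀ x → x ∈ S → x ≲ b

  Unbounded : Pred Carrier 0ℓ → Set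
  Unbounded S = ¬ (∃ λ b → b IsUpperBoundOf S)

  -- κ⁺-directedness: having size less than κ⁺ means having size at most κ.
  SuccDirected : Set → Set
  SuccDirected κ =
    (S : 𝒫 Carrier) → (∃ ⟦ S ⟧ ↣ κ) → ∃ λ b → b IsUpperBoundOf ⟦ S ⟧

ω₁-Directed : Quasiorder → Set
ω₁-Directed P = SuccDirected P ℕ

image : {X Y : Set} → (X → Y) → Pred X 0ℓ → Pred Y 0ℓ
image f S y = ∃ λ x → x ∈ S × y ≡ f x

-- The definition makes sense for all quasiorders; it is only applied to
-- directed ones.

IsTukey : (P Q : Quasiorder) → (Preorder.Carrier P → Preorder.Carrier Q) → Set
IsTukey P Q f =
  (S : 𝒫 (Preorder.Carrier P)) → Unbounded P ⟦ S ⟧ → Unbounded Q (image f ⟦ S ⟧)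

infix 4 _≤T_ _<T_

_≤T_ : Quasiorder → Quasiorder → Set
P ≤T Q = ∃ (IsTukey P Q)

_<T_ : Quasiorder → Quasiorder → Set
P <T Q = P ≤T Q × ¬ (Q ≤T P)

infix 4 _⊇*_

_⊇*_ : Rel (𝒫 ℕ) 0ℓ
A ⊇* B = Finite (⟦ B ⟧ ∖ ⟦ A ⟧)

⊇*-refl : ∀ A → A ⊇* A
⊇*-refl A = [] , λ (a , ¬a) → contradiction a ¬a

⊇*-trans : ∀ A B C → A ⊇* B → B ⊇* C → A ⊇* C
⊇*-trans A B C (xs , B∖A) (ys , C∖B) = xs ++ ys , λ {n} → go n
  where
  go : ∀ n → n ∈ ⟦ C ⟧ ∖ ⟦ A ⟧ → n List.∈ (xs ++ ys)
  go n (c , ¬a) with T? (B n)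
  ... | yes b = ∈-++⁺ˡ (B∖A (b , ¬a))
  ... | no ¬b = ∈-++⁺ʳ xs (C∖B (c , ¬b))

⟨_,⊇⟩ : 𝒫 (𝒫 ℕ) → Quasiorder
⟨ 𝒰 ,⊇⟩ = record
  { Carrier    = ∃ ⟦ 𝒰 ⟧
  ; _≈_        = _≡_
  ; _≲_        = λ (A , _) (B , _) → ⟦ B ⟧ ⊆ ⟦ A ⟧
  ; isPreorder = record
    { isEquivalence = isEquivalence
    ; reflexive     = λ { refl → id }
    ; trans         = λ B⊆A C⊆B n∈C → B⊆A (C⊆B n∈C)
    }
  }

⟨_,⊇*⟩ : 𝒫 (𝒫 ℕ) → Quasiorder
⟨ 𝒰 ,⊇*⟩ = record
  { Carrier    = ∃ ⟦ 𝒰 ⟧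
  ; _≈_        = _≡_
  ; _≲_        = λ (A , _) (B , _) → A ⊇* B
  ; isPreorder = record
    { isEquivalence = isEquivalence
    ; reflexive     = λ { {A , _} refl → ⊇*-refl A }
    ; trans         = λ { {A , _} {B , _} {C , _} → ⊇*-trans A B C }
    }
  }

⟨[_]^<ω,⊆⟩ : Set → Quasiorder
⟨[ X ]^<ω,⊆⟩ = record
  { Carrier    = ∃ λ (σ : 𝒫 X) → Finite ⟦ σ ⟧
  ; _≈_        = _≡_
  ; _≲_        = λ (σ , _) (τ , _) → ⟦ σ ⟧ ⊆ ⟦ τ ⟧
  ; isPreorder = record
    { isEquivalence = isEquivalence
    ; reflexive     = λ { refl → id }
    ; trans         = λ σ⊆τ τ⊆υ x∈σ → τ⊆υ (σ⊆τ x∈σ)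
    }
  }

record IsUltrafilter (𝒰 : 𝒫 (𝒫 ℕ)) : Set where
  field
    univ∈    : const true ∈ ⟦ 𝒰 ⟧
    empty∉   : const false ∉ ⟦ 𝒰 ⟧
    upward   : ∀ A B → ⟦ A ⟧ ⊆ ⟦ B ⟧ → A ∈ ⟦ 𝒰 ⟧ → B ∈ ⟦ 𝒰 ⟧
    ∩-closed : ∀ A B → A ∈ ⟦ 𝒰 ⟧ → B ∈ ⟦ 𝒰 ⟧ → (λ n → A n ∧ B n) ∈ ⟦ 𝒰 ⟧
    ultra    : ∀ A → A ∈ ⟦ 𝒰 ⟧ ⊎ (not ∘ A) ∈ ⟦ 𝒰 ⟧

Principal : 𝒫 (𝒫 ℕ) → Set
Principal 𝒰 = ∃ λ n → ∀ A → A ∈ ⟦ 𝒰 ⟧ ⇔ n ∈ ⟦ A ⟧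

IsPPoint : 𝒫 (𝒫 ℕ) → Set
IsPPoint 𝒰 = ω₁-Directed ⟨ 𝒰 ,⊇*⟩

⋂ : {X : Set} → 𝒫 (𝒫 X) → Pred X 0ℓ
⋂ σ x = ∀ A → A ∈ ⟦ σ ⟧ → x ∈ ⟦ A ⟧

SFIP : Pred (𝒫 (𝒫 ℕ)) 0ℓ
SFIP 𝒜 = (σ : 𝒫 (𝒫 ℕ)) → Finite ⟦ σ ⟧ → ⟦ σ ⟧ ⊆ ⟦ 𝒜 ⟧ → Infinite (⋂ σ)

HasPseudointersection : Pred (𝒫 (𝒫 ℕ)) 0ℓ
HasPseudointersection 𝒜 =
  ∃ λ (b : 𝒫 ℕ) → Infinite ⟦ b ⟧ × (∀ a → a ∈ ⟦ 𝒜 ⟧ → Finite (⟦ b ⟧ ∖ ⟦ a ⟧))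

𝔭-Witness : Pred (𝒫 (𝒫 ℕ)) 0ℓ
𝔭-Witness 𝒜 =
  (∀ A → A ∈ ⟦ 𝒜 ⟧ → Infinite ⟦ A ⟧) × SFIP 𝒜 × ¬ HasPseudointersection 𝒜

𝔭≡ : Set → Set
𝔭≡ K = K IsLeastCardinalityIn 𝔭-Witness

-- An ordinal, up to isomorphism, is a well-ordered type; α : Carrier stands
-- for the smaller ordinal { ξ ∣ ξ < α }.

record Ordinal : Set₁ where
  infix 4 _<_
  field
    Carrier            : Set
    _<_                : Rel Carrier 0ℓ
    isStrictTotalOrder : IsStrictTotalOrder _≡_ _<_
    wellFounded        : WellFounded _<_

  open StrictToNonStrict _≡_ _<_ public using (_≤_; isPreorder₂)

  quasiorder : Quasiorder
  quasiorder = record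
    { isPreorder = isPreorder₂
        (IsStrictTotalOrder.isStrictPartialOrder isStrictTotalOrder)
    }

module _ (κ : Ordinal) where
  open Ordinal κ

  -- κ is a cardinal: it has no injection into a smaller ordinal.
  IsInitial : Set
  IsInitial =
    ∀ α → ¬ (∃ λ (f : Carrier → Carrier) → Injective _≡_ _≡_ f × (∀ ξ → f ξ < α))

  -- κ = 2^ℵ₀, which determines κ up to isomorphism.
  IsContinuum : Set
  IsContinuum = IsInitial × (Carrier ⤖ 𝒫 ℕ)

  CofinalIn : Carrier → Pred (𝒫 Carrier) 0ℓ
  CofinalIn α S =
    ⟦ S ⟧ ⊆ (_< α) × (∀ ξ → ξ < α → ∃ λ η → η ∈ ⟦ S ⟧ × ξ ≤ η)

  E : Set → Pred Carrier 0ℓ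
  E lam α = lam IsLeastCardinalityIn CofinalIn α

  -- A nonzero α in which D is strictly cofinal is a limit.
  IsClosed : 𝒫 Carrier → Set
  IsClosed D =
    ∀ α → ∃ (_< α) →
    (∀ ξ → ξ < α → ∃ λ η → η ∈ ⟦ D ⟧ × ξ < η × η < α) →
    α ∈ ⟦ D ⟧

  IsClub : 𝒫 Carrier → Set
  IsClub D = IsClosed D × (∀ ξ → ∃ λ η → η ∈ ⟦ D ⟧ × ξ < η)

  Stationary : Pred Carrier 0ℓ → Set
  Stationary S = (D : 𝒫 Carrier) → IsClub D → ∃ λ α → α ∈ ⟦ D ⟧ × α ∈ S

  -- The values of Ξ outside S play no role.
  ◇ : Pred Carrier 0ℓ → Set
  ◇ S =
    ∃ λ (Ξ : Carrier → 𝒫 Carrier) →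
      (∀ α → α ∈ S → ⟦ Ξ α ⟧ ⊆ (_< α)) ×
      ((X : 𝒫 Carrier) →
        Stationary (λ α → α ∈ S × (⟦ X ⟧ ∩ (_< α)) ≐ ⟦ Ξ α ⟧))

{-# OPTIONS --safe #-}

-- Under 𝔭 = 𝔠 a transfinite recursion along 𝔠 yields a
-- ⊆*-decreasing tower T generating an ultrafilter V, in which every countable
-- family has a pseudointersection.  Take 𝒰 to be (a copy on ω of) the Fubini
-- product V ⊗ V.  The columns show that 𝒰 is not a P-point, whence
-- ⟨𝒰,⊇*⟩ ≰ 𝔠, because countable subsets of 𝔠 are bounded.  The map
-- α ↦ T α × ω is Tukey from 𝔠, because T has no pseudointersection.  Finally,
-- among any 𝔠 many members A y of 𝒰 there is one, A x, to which some sequence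
-- A (y k) with y increasing converges, jointly with the sets of rows
-- { i ∣ (A y)ᵢ ∈ V }; the interval argument for P-points, carried out for all
-- columns simultaneously, then gives infinitely many A (y k) whose
-- intersection is in 𝒰.
module Submission where

open import Defs
open import Axiom.ExcludedMiddle using (ExcludedMiddle)
open import Axiom.Extensionality.Propositional using (Extensionality)
open import Data.Bool using (Bool; true; false; not; _∧_; T)
open import Data.Bool.Properties using (T-∧; T-irrelevant; T?)
open import Data.Empty using (⊥-elim)
open import Data.Fin using (fromℕ<; toℕ)
open import Data.Fin.Properties using (toℕ-fromℕ<)
open import Data.List using (List; []; _∷_; upTo)
import Data.List.Membership.Propositional as List
open import Data.List.Membership.Propositional.Properties using (∈-upTo⁺)
open import Data.List.Relation.Unary.Any using (here; there)
open import Data.Nat using (ℕ; zero; suc; _+_; _*_; _⊔_; _≤_; _<_; z≤n; s≤s)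
open import Data.Nat.Binary using (ℕᵇ; 2[1+_]; 1+[2_])
import Data.Nat.Binary as ℕᵇ
open import Data.Nat.Binary.Properties using (fromℕ-toℕ; toℕ-fromℕ)
open import Data.Nat.Properties
open import Data.Product using (∃; Σ; _×_; _,_; proj₁; proj₂)
open import Data.Sum using (_⊎_; inj₁; inj₂; [_,_]′)
open import Data.Vec using (Vec; []; _∷_; lookup; tabulate)
open import Data.Vec.Properties using (lookup∘tabulate)
open import Function using (_∘_; id; const)
open import Function.Bundles using (Injection; Bijection; Equivalence; mk↣; _↣_)
open import Function.Definitions using (Injective)
open import Induction.WellFounded using (WfRec; module All; module FixPoint)
open import Level using (0ℓ)
open import Relation.Binary.Bundles using (Preorder)
open import Relation.Binary.Core using (Rel)
open import Relation.Binary.Definitions using (tri<; tri≈; tri>)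
open import Relation.Binary.PropositionalEquality
  using (_≡_; refl; sym; trans; cong; subst)
open import Relation.Binary.Structures using (IsStrictTotalOrder)
open import Relation.Nullary using (¬_; yes; no; contradiction)
open import Relation.Nullary.Decidable
  using (⌊_⌋; toWitness; fromWitness; decidable-stable)
open import Relation.Unary using (Pred; _∈_; _∉_; _⊆_)

-- Almost inclusion and infinite subsets of ω.

infix 4 _⊆*_

_⊆*_ : Rel (𝒫 ℕ) 0ℓ
A ⊆* B = ∃ λ N → ∀ n → N ≤ n → n ∈ ⟦ A ⟧ → n ∈ ⟦ B ⟧

Cofinal : Pred (Pred ℕ 0ℓ) 0ℓ
Cofinal S = ∀ N → ∃ λ n → N ≤ n × n ∈ S

⊆⇒⊆* : ∀ A B → ⟦ A ⟧ ⊆ ⟦ B ⟧ → A ⊆* B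
⊆⇒⊆* A B A⊆B = 0 , λ n _ → A⊆B

⊆*-trans : ∀ A B C → A ⊆* B → B ⊆* C → A ⊆* C
⊆*-trans A B C (M , A⊆B) (N , B⊆C) = M ⊔ N , λ n M⊔N≤n n∈A →
  B⊆C n (m⊔n≤o⇒n≤o M N M⊔N≤n) (A⊆B n (m⊔n≤o⇒m≤o M N M⊔N≤n) n∈A)

list-bounded : (xs : List ℕ) → ∃ λ N → ∀ n → n List.∈ xs → n < N
list-bounded [] = 0 , λ n ()
list-bounded (x ∷ xs) with list-bounded xs
... | N , xs<N = suc x ⊔ N , λ where
  n (here refl) → m≤m⊔n (suc x) N
  n (there n∈xs) → ≤-trans (xs<N n n∈xs) (m≤n⊔m (suc x) N)

⊇*⇒⊆* : ∀ A B → B ⊇* A → A ⊆* B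
⊇*⇒⊆* A B (xs , A∖B⊆xs) = let N , xs<N = list-bounded xs in N , λ n N≤n n∈A →
  decidable-stable (T? (B n)) λ n∉B → ≤⇒≯ N≤n (xs<N n (A∖B⊆xs (n∈A , n∉B)))

⊆*⇒⊇* : ∀ A B → A ⊆* B → B ⊇* A
⊆*⇒⊇* A B (N , A⊆B) = upTo N , λ {n} (n∈A , n∉B) →
  ∈-upTo⁺ (≰⇒> λ N≤n → n∉B (A⊆B n N≤n n∈A))

cofinal⇒infinite : ∀ {S} → Cofinal S → Infinite S
cofinal⇒infinite cof (xs , S⊆xs) with list-bounded xs
... | N , xs<N with cof N
... | n , N≤n , n∈S = ≤⇒≯ N≤n (xs<N n (S⊆xs n∈S))

∈-∧⁺ : ∀ {a b} → T a → T b → T (a ∧ b)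
∈-∧⁺ p q = Equivalence.from T-∧ (p , q)

∈-∧⁻ : ∀ {a b} → T (a ∧ b) → T a × T b
∈-∧⁻ = Equivalence.to T-∧

∈-not⁻ : ∀ b → T (not b) → ¬ T b
∈-not⁻ false _ ()

∈-not⁺ : ∀ b → ¬ T b → T (not b)
∈-not⁺ false _ = _
∈-not⁺ true ¬t = ¬t _

⊆*-∩ : ∀ A B C → A ⊆* B → A ⊆* C → A ⊆* (λ n → B n ∧ C n)
⊆*-∩ A B C (M , A⊆B) (N , A⊆C) = M ⊔ N , λ n le n∈A →
  ∈-∧⁺ (A⊆B n (m⊔n≤o⇒m≤o M N le) n∈A) (A⊆C n (m⊔n≤o⇒n≤o M N le) n∈A)

-- Increasing sequences and running maxima.

module StrictlyIncreasing (f : ℕ → ℕ) (f-step : ∀ n → f n < f (suc n)) where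

  mono-≤ : ∀ {i j} → i ≤ j → f i ≤ f j
  mono-≤ {j = zero} z≤n = ≤-refl
  mono-≤ {i} {suc j} i≤1+j with m≤n⇒m<n∨m≡n i≤1+j
  ... | inj₁ (s≤s i≤j) = ≤-trans (mono-≤ i≤j) (<⇒≤ (f-step j))
  ... | inj₂ refl = ≤-refl

  mono-< : ∀ {i j} → i < j → f i < f j
  mono-< {i} i<j = <-≤-trans (f-step i) (mono-≤ i<j)

  injective : Injective _≡_ _≡_ f
  injective {i} {j} fi≡fj with <-cmp i j
  ... | tri< i<j _ _ = contradiction fi≡fj (<⇒≢ (mono-< i<j))
  ... | tri≈ _ i≡j _ = i≡j
  ... | tri> _ _ j<i = contradiction (sym fi≡fj) (<⇒≢ (mono-< j<i))

  n≤f[n] : ∀ n → n ≤ f n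
  n≤f[n] zero = z≤n
  n≤f[n] (suc n) = ≤-<-trans (n≤f[n] n) (f-step n)

⨆ : (ℕ → ℕ) → ℕ → ℕ
⨆ f zero = f 0
⨆ f (suc n) = ⨆ f n ⊔ f (suc n)

≤-⨆ : ∀ f {i n} → i ≤ n → f i ≤ ⨆ f n
≤-⨆ f {n = zero} z≤n = ≤-refl
≤-⨆ f {i} {suc n} i≤1+n with m≤n⇒m<n∨m≡n i≤1+n
... | inj₁ (s≤s i≤n) = ≤-trans (≤-⨆ f i≤n) (m≤m⊔n _ _)
... | inj₂ refl = m≤n⊔m (⨆ f n) _

-- ω is split into infinitely many infinite columns: k lies in column i if its
-- bijective binary numeral ends in exactly i digits 2.  enc need not be onto.

row′ : ℕᵇ → ℕ
row′ ℕᵇ.zero = 0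
row′ 2[1+ b ] = suc (row′ b)
row′ 1+[2 b ] = 0

enc′ : ℕ → ℕ → ℕᵇ
enc′ zero j = 1+[2 ℕᵇ.fromℕ j ]
enc′ (suc i) j = 2[1+ enc′ i j ]

row : ℕ → ℕ
row = row′ ∘ ℕᵇ.fromℕ

enc : ℕ → ℕ → ℕ
enc i j = ℕᵇ.toℕ (enc′ i j)

row-enc′ : ∀ i j → row′ (enc′ i j) ≡ i
row-enc′ zero j = refl
row-enc′ (suc i) j = cong suc (row-enc′ i j)

row-enc : ∀ i j → row (enc i j) ≡ i
row-enc i j = trans (cong row′ (fromℕ-toℕ (enc′ i j))) (row-enc′ i j)

-- Turns infinitely many j in one column into arbitrarily large points `enc i j` of ω.
j≤enc : ∀ i j → j ≤ enc i j
j≤enc zero j = subst (λ k → j ≤ suc (2 * k)) (sym (toℕ-fromℕ j))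
  (≤-trans (m≤m+n j (j + 0)) (n≤1+n _))
j≤enc (suc i) j =
  ≤-trans (≤-trans (j≤enc i j) (n≤1+n _)) (m≤m+n (suc (enc i j)) _)

-- Classical facts on infinite sets, chains and power sets.

module Classical (em : ExcludedMiddle 0ℓ) where

  stable : {P : Set} → ¬ ¬ P → P
  stable = decidable-stable em

  set : {X : Set} → Pred X 0ℓ → 𝒫 X
  set P x = ⌊ em {P x} ⌋

  set⁺ : {X : Set} (P : Pred X 0ℓ) {x : X} → P x → x ∈ ⟦ set P ⟧
  set⁺ P = fromWitness

  set⁻ : {X : Set} (P : Pred X 0ℓ) {x : X} → x ∈ ⟦ set P ⟧ → P x
  set⁻ P = toWitness

  ¬cofinal⇒bounded : ∀ {S} → ¬ Cofinal S → ∃ λ N → ∀ n → N ≤ n → n ∉ S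
  ¬cofinal⇒bounded ¬cof = stable λ ¬bdd → ¬cof λ N → stable λ ¬n →
    ¬bdd (N , λ n N≤n n∈S → ¬n (n , N≤n , n∈S))

  infinite⇒cofinal : ∀ {S} → Infinite S → Cofinal S
  infinite⇒cofinal inf = stable λ ¬cof →
    let N , N∉S = ¬cofinal⇒bounded ¬cof in
    inf (upTo N , λ {n} n∈S → ∈-upTo⁺ (≰⇒> λ N≤n → N∉S n N≤n n∈S))

  -- If b meets X only below some bound, then b without X is still infinite. This decides one more
  -- set at each stage of the tower.
  halve : (b X : 𝒫 ℕ) → Cofinal ⟦ b ⟧ → ∃ λ R → Cofinal ⟦ R ⟧ ×
    ⟦ R ⟧ ⊆ ⟦ b ⟧ × (⟦ R ⟧ ⊆ ⟦ X ⟧ ⊎ ⟦ R ⟧ ⊆ ⟦ not ∘ X ⟧)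
  halve b X cof with em {Cofinal ⟦ (λ n → b n ∧ X n) ⟧}
  ... | yes cof∧ = _ , cof∧ , proj₁ ∘ ∈-∧⁻ , inj₁ (λ {n} → proj₂ ∘ ∈-∧⁻ {b n})
  ... | no ¬cof = (λ n → b n ∧ not (X n)) , cof∖ ,
                  proj₁ ∘ ∈-∧⁻ , inj₂ (λ {n} → proj₂ ∘ ∈-∧⁻ {b n})
    where
    cof∖ : Cofinal ⟦ (λ n → b n ∧ not (X n)) ⟧
    cof∖ N with ¬cofinal⇒bounded ¬cof
    ... | M , M∉ with cof (N ⊔ M)
    ... | n , le , n∈b = n , m⊔n≤o⇒m≤o N M le , ∈-∧⁺ n∈b
      (∈-not⁺ (X n) λ n∈X → M∉ n (m⊔n≤o⇒n≤o N M le) (∈-∧⁺ n∈b n∈X))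

  -- X consists of the even-indexed terms of an increasing sequence in b, so that the even and the
  -- odd terms witness the two failures. Hence no infinite set is almost contained in every member
  -- of an ultrafilter.
  split : (b : 𝒫 ℕ) → Cofinal ⟦ b ⟧ →
    ∃ λ X → ¬ (b ⊆* X) × ¬ (b ⊆* (not ∘ X))
  split b cof = X , not-in , not-out
    where
    f : ℕ → ℕ
    f zero = proj₁ (cof 0)
    f (suc n) = proj₁ (cof (suc (f n)))

    f∈b : ∀ n → f n ∈ ⟦ b ⟧
    f∈b zero = proj₂ (proj₂ (cof 0))
    f∈b (suc n) = proj₂ (proj₂ (cof (suc (f n))))

    open StrictlyIncreasing f (λ n → proj₁ (proj₂ (cof (suc (f n)))))

    Even = λ x → ∃ λ k → x ≡ f (2 * k)
    X = set Even

    N≤2N : ∀ N → N ≤ 2 * N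
    N≤2N N = m≤m+n N (N + 0)

    not-in : ¬ (b ⊆* X)
    not-in (N , b⊆X) =
      let k , eq = set⁻ Even (b⊆X (f (suc (2 * N)))
            (≤-trans (≤-trans (N≤2N N) (n≤1+n _)) (n≤f[n] (suc (2 * N))))
            (f∈b (suc (2 * N))))
      in even≢odd k N (sym (injective eq))

    not-out : ¬ (b ⊆* (not ∘ X))
    not-out (N , b⊆X) = ∈-not⁻ _
      (b⊆X (f (2 * N)) (≤-trans (N≤2N N) (n≤f[n] (2 * N))) (f∈b (2 * N)))
      (set⁺ Even (N , refl))

  -- C is the ⊆*-least of the members of the chain 𝒜 met so far, or the whole
  -- of ω if there are none.
  chain⇒SFIP : (𝒜 : 𝒫 (𝒫 ℕ)) →
    (∀ A → A ∈ ⟦ 𝒜 ⟧ → Cofinal ⟦ A ⟧) →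
    (∀ A B → A ∈ ⟦ 𝒜 ⟧ → B ∈ ⟦ 𝒜 ⟧ → A ⊆* B ⊎ B ⊆* A) → SFIP 𝒜
  chain⇒SFIP 𝒜 cof linear σ (As , σ⊆As) σ⊆𝒜 with least As
    where
    least : (As : List (𝒫 ℕ)) → ∃ λ C →
      Cofinal ⟦ C ⟧ × (∀ A → A ∈ ⟦ 𝒜 ⟧ → C ⊆* A ⊎ A ⊆* C) ×
      ∃ λ N → ∀ A → A List.∈ As → A ∈ ⟦ 𝒜 ⟧ →
        ∀ n → N ≤ n → n ∈ ⟦ C ⟧ → n ∈ ⟦ A ⟧
    least [] = const true , (λ N → N , ≤-refl , _) ,
      (λ A _ → inj₂ (0 , λ _ _ _ → _)) , 0 , λ _ ()
    least (A ∷ As) with least As | T? (𝒜 A)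
    ... | C , cofC , linC , N , C⊆As | no A∉𝒜 =
      C , cofC , linC , N , λ where
        _ (here refl) A∈𝒜 → contradiction A∈𝒜 A∉𝒜
        B (there B∈As) → C⊆As B B∈As
    ... | C , cofC , linC , N , C⊆As | yes A∈𝒜 with linC A A∈𝒜
    ... | inj₁ (M , C⊆A) = C , cofC , linC , M ⊔ N , λ where
        _ (here refl) _ n le → C⊆A n (m⊔n≤o⇒m≤o M N le)
        B (there B∈As) B∈𝒜 n le → C⊆As B B∈As B∈𝒜 n (m⊔n≤o⇒n≤o M N le)
    ... | inj₂ (M , A⊆C) =
      A , cof A A∈𝒜 , (λ B → linear A B A∈𝒜) , M ⊔ N , λ where
        _ (here refl) _ n le → id
        B (there B∈As) B∈𝒜 n le →
          C⊆As B B∈As B∈𝒜 n (m⊔n≤o⇒n≤o M N le) ∘ A⊆C n (m⊔n≤o⇒m≤o M N le)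
  ... | C , cofC , _ , N , C⊆As = cofinal⇒infinite λ M →
    let n , le , n∈C = cofC (M ⊔ N) in
    n , m⊔n≤o⇒m≤o M N le , λ A A∈σ →
      C⊆As A (σ⊆As A∈σ) (σ⊆𝒜 A∈σ) n (m⊔n≤o⇒n≤o M N le) n∈C

  -- D collects the codes of sets that omit their own code. If `h D` were in D, injectivity would
  -- identify D with a set omitting its code.
  cantor : {X : Set} (h : 𝒫 X → X) → ¬ Injective _≡_ _≡_ h
  cantor h h-inj = d∉D (set⁺ Diag (D , refl , d∉D))
    where
    Diag = λ x → ∃ λ A → x ≡ h A × h A ∉ ⟦ A ⟧
    D = set Diag

    d∉D : h D ∉ ⟦ D ⟧
    d∉D d∈D with set⁻ Diag d∈D
    ... | A , hD≡hA , hA∉A with h-inj hD≡hA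
    ... | refl = hA∉A d∈D

-- Pseudointersections of short chains, and the tower.

module _
  (em : ExcludedMiddle 0ℓ) (ext : Extensionality 0ℓ 0ℓ)
  (𝔠 : Ordinal) (continuum : IsContinuum 𝔠)
  (𝔭≡𝔠 : 𝔭≡ (Ordinal.Carrier 𝔠))
  where

  open Classical em
  open Ordinal 𝔠 renaming (Carrier to K; _<_ to _≺_; _≤_ to _≼_)
  open IsStrictTotalOrder isStrictTotalOrder using (compare)
    renaming (trans to ≺-trans)

  ≼-trans : ∀ {α β γ} → α ≼ β → β ≼ γ → α ≼ γ
  ≼-trans = Preorder.trans quasiorder

  X : K → 𝒫 ℕ
  X = Bijection.to (proj₂ continuum)

  index : 𝒫 ℕ → K
  index A = proj₁ (Bijection.surjective (proj₂ continuum) A)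

  X-index : ∀ A → X (index A) ≡ A
  X-index A = proj₂ (Bijection.surjective (proj₂ continuum) A) refl

  index-injective : Injective _≡_ _≡_ index
  index-injective {A} {B} eq =
    trans (sym (X-index A)) (trans (cong X eq) (X-index B))

  opaque
    -- The range of F is a chain of infinite sets and so has the SFIP. Without a pseudointersection
    -- it would be a `𝔭-Witness`, and 𝔭 = 𝔠 would inject K into it, against the last hypothesis.
    chain-pseudointersection : {I : Set} (F : I → 𝒫 ℕ) →
      (∀ i → Cofinal ⟦ F i ⟧) → (∀ i j → F i ⊆* F j ⊎ F j ⊆* F i) →
      ¬ (∃ λ (h : K → I) → Injective _≡_ _≡_ (F ∘ h)) →
      ∃ λ b → Cofinal ⟦ b ⟧ × ∀ i → b ⊆* F i
    chain-pseudointersection {I} F cof linear K≰I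
      with em {HasPseudointersection (set λ A → ∃ λ i → A ≡ F i)}
    ... | yes (b , inf , b⊆) = b , infinite⇒cofinal inf ,
      λ i → ⊇*⇒⊆* b (F i) (b⊆ (F i) (set⁺ (λ A → ∃ λ i → A ≡ F i) (i , refl)))
    ... | no ¬b = ⊥-elim (K≰I (h , h-injective))
      where
      Range : Pred (𝒫 ℕ) 0ℓ
      Range A = ∃ λ i → A ≡ F i

      𝒜 : 𝒫 (𝒫 ℕ)
      𝒜 = set Range

      𝒜-cofinal : ∀ A → A ∈ ⟦ 𝒜 ⟧ → Cofinal ⟦ A ⟧
      𝒜-cofinal A A∈𝒜 with set⁻ Range A∈𝒜
      ... | i , refl = cof i

      𝒜-linear : ∀ A B → A ∈ ⟦ 𝒜 ⟧ → B ∈ ⟦ 𝒜 ⟧ → A ⊆* B ⊎ B ⊆* A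
      𝒜-linear A B A∈𝒜 B∈𝒜 with set⁻ Range A∈𝒜 | set⁻ Range B∈𝒜
      ... | i , refl | j , refl = linear i j

      K↣𝒜 : K ↣ ∃ ⟦ 𝒜 ⟧
      K↣𝒜 = proj₂ 𝔭≡𝔠 𝒜
        ( (λ A → cofinal⇒infinite ∘ 𝒜-cofinal A)
        , chain⇒SFIP 𝒜 𝒜-cofinal 𝒜-linear , ¬b)

      member : K → ∃ ⟦ 𝒜 ⟧
      member = Injection.to K↣𝒜

      h : K → I
      h ξ = proj₁ (set⁻ Range (proj₂ (member ξ)))

      member≡F : ∀ ξ → proj₁ (member ξ) ≡ F (h ξ)
      member≡F ξ = proj₂ (set⁻ Range (proj₂ (member ξ)))

      ∃-≡ : {p q : ∃ ⟦ 𝒜 ⟧} → proj₁ p ≡ proj₁ q → p ≡ q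
      ∃-≡ {A , a} {_ , b} refl = cong (A ,_) (T-irrelevant a b)

      h-injective : Injective _≡_ _≡_ (F ∘ h)
      h-injective {ξ} {ξ′} eq = Injection.injective K↣𝒜
        (∃-≡ (trans (member≡F ξ) (trans eq (sym (member≡F ξ′)))))

  -- The demands on stage α. As `X` enumerates all subsets of ω, meeting `decides` at every stage
  -- makes the tower generate an ultrafilter.
  record Extends (α : K) (prev : ∀ β → β ≺ α → 𝒫 ℕ) (R : 𝒫 ℕ) : Set where
    field
      cofinal : Cofinal ⟦ R ⟧
      below   : ∀ β β≺α → R ⊆* prev β β≺α
      decides : ⟦ R ⟧ ⊆ ⟦ X α ⟧ ⊎ ⟦ R ⟧ ⊆ ⟦ not ∘ X α ⟧

  -- The default value keeps the recursion total, so that the tower can be defined first and shown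
  -- correct by a separate induction.
  extend : ∀ α → (∀ β → β ≺ α → 𝒫 ℕ) → 𝒫 ℕ
  extend α prev with em {∃ (Extends α prev)}
  ... | yes (R , _) = R
  ... | no _ = const true

  extend-extends : ∀ α prev → ∃ (Extends α prev) →
    Extends α prev (extend α prev)
  extend-extends α prev ∃R with em {∃ (Extends α prev)}
  ... | yes (_ , R) = R
  ... | no ∄R = contradiction ∃R ∄R

  step : ∀ α → WfRec _≺_ (λ _ → 𝒫 ℕ) α → 𝒫 ℕ
  step α IH = extend α λ β β≺α → IH β≺α

  step-ext : ∀ α {IH IH′ : WfRec _≺_ (λ _ → 𝒫 ℕ) α} →
    (∀ {β} (β≺α : β ≺ α) → IH β≺α ≡ IH′ β≺α) → step α IH ≡ step α IH′
  step-ext α eq = cong (extend α) (ext λ β → ext λ β≺α → eq β≺α)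

  opaque
    tower : K → 𝒫 ℕ
    tower = All.wfRec wellFounded 0ℓ (λ _ → 𝒫 ℕ) step

    tower-unfold : ∀ α → tower α ≡ extend α (λ β _ → tower β)
    tower-unfold α = FixPoint.unfold-wfRec wellFounded (λ _ → 𝒫 ℕ) step step-ext

  opaque
    -- The levels below α form a chain. Since 𝔠 is initial, K does not inject into its index set, so
    -- the chain has a pseudointersection, and half of that decides `X α`.
    tower-extends : ∀ α → Extends α (λ β _ → tower β) (tower α)
    tower-extends = All.wfRec wellFounded 0ℓ _ λ α IH →
      subst (Extends α _) (sym (tower-unfold α))
        (extend-extends α _ (extension α (λ β β≺α → IH {β} β≺α)))
      where
      extension : ∀ α → (∀ β → β ≺ α → Extends β (λ γ _ → tower γ) (tower β)) →
        ∃ (Extends α (λ β _ → tower β))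
      extension α IH with chain-pseudointersection {∃ (_≺ α)} (tower ∘ proj₁)
          (λ (β , β≺α) → Extends.cofinal (IH β β≺α)) linear
          (λ (h , h-inj) → proj₁ continuum α
            (proj₁ ∘ h , (λ eq → h-inj (cong tower eq)) , proj₂ ∘ h))
        where
        linear : ∀ (i j : ∃ (_≺ α)) → tower (proj₁ i) ⊆* tower (proj₁ j) ⊎
                                      tower (proj₁ j) ⊆* tower (proj₁ i)
        linear (β , β≺α) (γ , γ≺α) with compare β γ
        ... | tri< β≺γ _ _ = inj₂ (Extends.below (IH γ γ≺α) β β≺γ)
        ... | tri≈ _ refl _ = inj₁ (⊆⇒⊆* (tower β) (tower β) id)
        ... | tri> _ _ γ≺β = inj₁ (Extends.below (IH β β≺α) γ γ≺β)
      ... | b , cof , b⊆ with halve b (X α) cof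
      ... | R , cofR , R⊆b , dec = R , record
        { cofinal = cofR
        ; below = λ β β≺α →
            ⊆*-trans R b (tower β) (⊆⇒⊆* R b R⊆b) (b⊆ (β , β≺α))
        ; decides = dec
        }

  tower-cofinal : ∀ α → Cofinal ⟦ tower α ⟧
  tower-cofinal α = Extends.cofinal (tower-extends α)

  tower-anti : ∀ {α β} → α ≼ β → tower β ⊆* tower α
  tower-anti {α} {β} (inj₁ α≺β) = Extends.below (tower-extends β) α α≺β
  tower-anti {α} (inj₂ refl) = ⊆⇒⊆* (tower α) (tower α) id

  ≼-total : ∀ α β → α ≼ β ⊎ β ≼ α
  ≼-total α β with compare α β
  ... | tri< α≺β _ _ = inj₁ (inj₁ α≺β)
  ... | tri≈ _ α≡β _ = inj₁ (inj₂ α≡β)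
  ... | tri> _ _ β≺α = inj₂ (inj₁ β≺α)

  ⋠⇒≻ : ∀ {α β} → ¬ (α ≼ β) → β ≺ α
  ⋠⇒≻ {α} {β} α⋠β with compare α β
  ... | tri< α≺β _ _ = contradiction (inj₁ α≺β) α⋠β
  ... | tri≈ _ α≡β _ = contradiction (inj₂ α≡β) α⋠β
  ... | tri> _ _ β≺α = β≺α

  -- The ultrafilter V generated by the tower.

  V : Pred (𝒫 ℕ) 0ℓ
  V A = ∃ λ α → tower α ⊆* A

  V-tower : ∀ α → V (tower α)
  V-tower α = α , tower-anti (inj₂ refl)

  V-upward : ∀ A B → A ⊆* B → V A → V B
  V-upward A B A⊆B (α , T⊆A) = α , ⊆*-trans (tower α) A B T⊆A A⊆B

  V-⊆ : ∀ A B → ⟦ A ⟧ ⊆ ⟦ B ⟧ → V A → V B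
  V-⊆ A B A⊆B = V-upward A B (⊆⇒⊆* A B A⊆B)

  V-full : V (const true)
  V-full = index (const true) , 0 , λ _ _ _ → _

  V-∩ : ∀ A B → V A → V B → V (λ n → A n ∧ B n)
  V-∩ A B (α , α⊆A) (β , β⊆B) with ≼-total α β
  ... | inj₁ α≼β = β , ⊆*-∩ (tower β) A B
    (⊆*-trans (tower β) (tower α) A (tower-anti α≼β) α⊆A) β⊆B
  ... | inj₂ β≼α = α , ⊆*-∩ (tower α) A B
    α⊆A (⊆*-trans (tower α) (tower β) B (tower-anti β≼α) β⊆B)

  V-ultra : ∀ A → V A ⊎ V (not ∘ A)
  V-ultra A with Extends.decides (tower-extends (index A))
  ... | inj₁ T⊆A = inj₁ (index A , 0 , λ n _ n∈T →
    subst (λ B → n ∈ ⟦ B ⟧) (X-index A) (T⊆A n∈T))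
  ... | inj₂ T⊆A = inj₂ (index A , 0 , λ n _ n∈T →
    subst (λ B → n ∈ ⟦ not ∘ B ⟧) (X-index A) (T⊆A n∈T))

  V-cofinal : ∀ {A} → V A → Cofinal ⟦ A ⟧
  V-cofinal (α , M , T⊆A) N with tower-cofinal α (M ⊔ N)
  ... | n , le , n∈T = n , m⊔n≤o⇒n≤o M N le , T⊆A n (m⊔n≤o⇒m≤o M N le) n∈T

  -- Such a b would be almost contained in every member of V, in particular in Y or its complement,
  -- where Y splits b.
  tower-no-pseudointersection :
    ∀ {b} → Cofinal ⟦ b ⟧ → ¬ (∀ α → b ⊆* tower α)
  tower-no-pseudointersection {b} cof b⊆ with split b cof
  ... | Y , ¬in , ¬out with V-ultra Y
  ... | inj₁ (α , T⊆Y) = ¬in (⊆*-trans b (tower α) Y (b⊆ α) T⊆Y)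
  ... | inj₂ (α , T⊆Y) = ¬out (⊆*-trans b (tower α) (not ∘ Y) (b⊆ α) T⊆Y)

  -- Cofinality of 𝔠 and condensation.

  no-maximum : ∀ β → ¬ (∀ α → α ≼ β)
  no-maximum β max =
    tower-no-pseudointersection (tower-cofinal β) λ α → tower-anti (max α)

  -- Amounts to |I| < cf(𝔠), because K has no maximum.
  SmallIndex : Set → Set
  SmallIndex I = (h : I → K) → ∃ λ β → ∀ i → h i ≼ β

  opaque
    -- An unbounded sequence of levels is cofinal in the tower, so a pseudointersection of these
    -- countably many levels would be one of the whole tower.
    ℕ-small : SmallIndex ℕ
    ℕ-small h = stable λ unbounded →
      let b , cof , b⊆ = chain-pseudointersection (tower ∘ h)
            (tower-cofinal ∘ h) linear
            -- An injection of K into ℕ would yield one of 𝒫 ℕ into ℕ.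
            (λ (g , g-inj) → cantor (g ∘ index) λ eq →
              index-injective (g-inj (cong (tower ∘ h) eq)))
      in tower-no-pseudointersection cof λ α →
        let i , α≼hi = above unbounded α in
        ⊆*-trans b (tower (h i)) (tower α) (b⊆ i) (tower-anti α≼hi)
      where
      linear : ∀ i j → tower (h i) ⊆* tower (h j) ⊎ tower (h j) ⊆* tower (h i)
      linear i j with ≼-total (h i) (h j)
      ... | inj₁ le = inj₂ (tower-anti le)
      ... | inj₂ le = inj₁ (tower-anti le)

      above : ¬ (∃ λ β → ∀ i → h i ≼ β) → ∀ α → ∃ λ i → α ≼ h i
      above unbounded α = stable λ none → unbounded (α , λ i →
        stable λ hi⋠α → none (i , inj₁ (⋠⇒≻ hi⋠α)))

  Bool-small : SmallIndex Bool
  Bool-small h with ≼-total (h true) (h false)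
  ... | inj₁ le = h false , λ { false → inj₂ refl ; true → le }
  ... | inj₂ le = h true , λ { false → le ; true → inj₂ refl }

  Σ-small : {I : Set} {J : I → Set} →
    SmallIndex I → (∀ i → SmallIndex (J i)) → SmallIndex (Σ I J)
  Σ-small I-small J-small h =
    let β , le = I-small λ i → proj₁ (J-small i λ j → h (i , j)) in
    β , λ (i , j) → ≼-trans (proj₂ (J-small i λ j → h (i , j)) j) (le i)

  Vec-small : {A : Set} → SmallIndex A → ∀ n → SmallIndex (Vec A n)
  Vec-small A-small zero h = h [] , λ { [] → inj₂ refl }
  Vec-small A-small (suc n) h =
    let β , le = Σ-small A-small (λ _ → Vec-small A-small n)
          (λ (a , v) → h (a ∷ v))
    in β , λ { (a ∷ v) → le (a , v) }

  -- Otherwise every x is bounded by a bound of one of the countably many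
  -- bounded approximation classes.
  opaque
    condensation : (P : ℕ → Set) → (∀ n → SmallIndex (P n)) →
      (π : ∀ n → K → P n) →
      ∃ λ x → ∀ n β → ∃ λ y → β ≺ y × π n y ≡ π n x
    condensation P P-small π = stable λ none →
      let β , le = Σ-small ℕ-small P-small (λ (n , s) → bound n s) in
      no-maximum β λ x →
        let n , bdd = bounded-class none x in
        ≼-trans (bound-bounds n (π n x) bdd x refl) (le (n , π n x))
      where
      BoundedClass : ∀ n → P n → Set
      BoundedClass n s = ∃ λ β → ∀ y → π n y ≡ s → y ≼ β

      bounded-class : ¬ (∃ λ x → ∀ n β → ∃ λ y → β ≺ y × π n y ≡ π n x) →
        ∀ x → ∃ λ n → BoundedClass n (π n x)
      bounded-class none x = stable λ ¬bdd → none (x , λ n β → stable λ ¬y →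
        ¬bdd (n , β , λ y eq → stable λ y⋠β → ¬y (y , ⋠⇒≻ y⋠β , eq)))

      bound : ∀ n → P n → K
      bound n s with em {BoundedClass n s}
      ... | yes (β , _) = β
      ... | no _ = index (const true)

      bound-bounds : ∀ n s → BoundedClass n s → ∀ y → π n y ≡ s → y ≼ bound n s
      bound-bounds n s bdd with em {BoundedClass n s}
      ... | yes (_ , le) = le
      ... | no ¬bdd = contradiction bdd ¬bdd

  -- Diagonalization inside V.

  opaque
    -- Each `C k` in V almost contains some level of the tower, and by `ℕ-small` a single level β
    -- lies above these countably many.
    V-pseudointersection : (C : ℕ → 𝒫 ℕ) →
      ∃ λ D → V D × ∀ k → V (C k) → D ⊆* C k
    V-pseudointersection C = tower β , V-tower β , λ k Ck∈V →
      ⊆*-trans (tower β) (tower (generator k)) (C k)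
        (tower-anti (proj₂ (ℕ-small generator) k)) (generates k Ck∈V)
      where
      generator : ℕ → K
      generator k with em {V (C k)}
      ... | yes (α , _) = α
      ... | no _ = index (const true)

      generates : ∀ k → V (C k) → tower (generator k) ⊆* C k
      generates k Ck∈V with em {V (C k)}
      ... | yes (_ , T⊆C) = T⊆C
      ... | no Ck∉V = contradiction Ck∈V Ck∉V

      β : K
      β = proj₁ (ℕ-small generator)

  -- For n ≥ i, C (suc (m n)) i agrees with L i below m n and contains D i from
  -- m (suc n) on.  The gap [m n , m (suc n)) is avoided by passing to all even
  -- or to all odd n.
  module _ (C : ℕ → ℕ → 𝒫 ℕ) (L D : ℕ → 𝒫 ℕ)
    (agree : ∀ k i x → i < k → x < k → C k i x ≡ L i x)
    (almost : ∀ i k → V (C k i) → D i ⊆* C k i)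
    where

    M : ℕ → ℕ → ℕ
    M k i with em {V (C k i)}
    ... | yes Cki∈V = proj₁ (almost i k Cki∈V)
    ... | no _ = 0

    beyond-M : ∀ k i → V (C k i) →
      ∀ x → M k i ≤ x → x ∈ ⟦ D i ⟧ → x ∈ ⟦ C k i ⟧
    beyond-M k i Cki∈V with em {V (C k i)}
    ... | yes v = proj₂ (almost i k v)
    ... | no Cki∉V = contradiction Cki∈V Cki∉V

    m : ℕ → ℕ
    m zero = 0
    m (suc n) = suc (m n) ⊔ ⨆ (M (suc (m n))) n

    m-step : ∀ n → m n < m (suc n)
    m-step n = m≤m⊔n (suc (m n)) (⨆ (M (suc (m n))) n)

    module m = StrictlyIncreasing m m-step

    Gap : (ℕ → ℕ) → Pred ℕ 0ℓ
    Gap r x = ∃ λ n → m (r n) ≤ x × x < m (suc (r n))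

    -- Column i is controlled only for n ≥ i. The finitely many smaller n are left to a finite
    -- intersection in V.
    Subsequence : Set
    Subsequence = ∃ λ (e : ℕ → ℕ) → Injective _≡_ _≡_ e ×
      ∃ λ Y → V Y × ∀ i n → i ≤ n → V (C (e n) i) →
        ∀ x → x ∈ ⟦ Y ⟧ → x ∈ ⟦ L i ⟧ → x ∈ ⟦ D i ⟧ → x ∈ ⟦ C (e n) i ⟧

    avoiding-gaps : (r : ℕ → ℕ) → (∀ n → r n < r (suc n)) →
      V (not ∘ set (Gap r)) → Subsequence
    avoiding-gaps r r-step gap∉V =
      (λ n → suc (m (r n))) , r.injective ∘ m.injective ∘ suc-injective ,
      not ∘ set (Gap r) , gap∉V , λ i n i≤n Ceni∈V x x∉Gap x∈L x∈D →
        case i n i≤n Ceni∈V x x∉Gap x∈L x∈D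
      where
      module r = StrictlyIncreasing r r-step

      case : ∀ i n → i ≤ n → V (C (suc (m (r n))) i) → ∀ x →
        x ∈ ⟦ not ∘ set (Gap r) ⟧ → x ∈ ⟦ L i ⟧ → x ∈ ⟦ D i ⟧ →
        x ∈ ⟦ C (suc (m (r n))) i ⟧
      case i n i≤n Ceni∈V x x∉Gap x∈L x∈D with em {x < m (r n)}
      -- Here x lies below the gap. The successor in the index supplies the strict bound on i that
      -- `agree` needs.
      ... | yes x<m = subst T (sym (agree _ i x
              (s≤s (≤-trans i≤r (m.n≤f[n] (r n)))) (≤-trans x<m (n≤1+n _)))) x∈L
        where i≤r = ≤-trans i≤n (r.n≤f[n] n)
      -- Having avoided the gap, x lies beyond the thresholds of all columns up to `r n`, hence of
      -- column i.
      ... | no x≮m = beyond-M _ i Ceni∈V x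
              (≤-trans (≤-trans (≤-⨆ (M (suc (m (r n)))) i≤r)
                (m≤n⊔m (suc (m (r n))) (⨆ (M (suc (m (r n)))) (r n)))) m≤x) x∈D
        where
        i≤r = ≤-trans i≤n (r.n≤f[n] n)
        m≤x : m (suc (r n)) ≤ x
        m≤x = ≮⇒≥ λ x<m →
          ∈-not⁻ _ x∉Gap (set⁺ (Gap r) (n , ≮⇒≥ x≮m , x<m))

    even odd : ℕ → ℕ
    even n = 2 * n
    odd n = suc (2 * n)

    even-step : ∀ n → even n < even (suc n)
    even-step n = *-monoʳ-< 2 (n<1+n n)

    even-gap⇒¬odd-gap : ∀ {x} → Gap even x → ¬ Gap odd x
    even-gap⇒¬odd-gap {x} (k , mk≤x , x<mk) (l , ml≤x , x<ml) with <-cmp k l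
    ... | tri< k<l _ _ = <⇒≱ x<mk (≤-trans (m.mono-≤ (s≤s (*-monoʳ-≤ 2 (<⇒≤ k<l)))) ml≤x)
    ... | tri≈ _ refl _ = <⇒≱ x<mk ml≤x
    ... | tri> _ _ l<k = <⇒≱ x<ml (≤-trans (m.mono-≤
            (≤-trans (≤-reflexive (sym (*-suc 2 l))) (*-monoʳ-≤ 2 l<k))) mk≤x)

    -- Even and odd gaps are disjoint, so at least one of the two unions has its complement in V.
    diagonal-subsequence : Subsequence
    diagonal-subsequence with V-ultra (set (Gap even))
    ... | inj₂ gap∉V = avoiding-gaps even even-step gap∉V
    ... | inj₁ gap∈V = avoiding-gaps odd (s≤s ∘ even-step)
      (V-⊆ (set (Gap even)) (not ∘ set (Gap odd)) (λ x∈ → ∈-not⁺ _ λ x∈′ →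
        even-gap⇒¬odd-gap (set⁻ (Gap even) x∈) (set⁻ (Gap odd) x∈′)) gap∈V)

  -- The Fubini product 𝒰 of V with itself.

  col : 𝒫 ℕ → ℕ → 𝒫 ℕ
  col A i j = A (enc i j)

  rows : 𝒫 ℕ → 𝒫 ℕ
  rows A = set (V ∘ col A)

  𝒰 : 𝒫 (𝒫 ℕ)
  𝒰 = set (V ∘ rows)

  𝒰⁺ : ∀ A I → V I → (∀ i → i ∈ ⟦ I ⟧ → V (col A i)) → A ∈ ⟦ 𝒰 ⟧
  𝒰⁺ A I I∈V cols = set⁺ (V ∘ rows) {A}
    (V-⊆ I (rows A) (λ {i} i∈I → set⁺ (V ∘ col A) {i} (cols i i∈I)) I∈V)

  𝒰⁻ : ∀ A → A ∈ ⟦ 𝒰 ⟧ → V (rows A)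
  𝒰⁻ A = set⁻ (V ∘ rows) {A}

  row∈⇒col : ∀ A i → i ∈ ⟦ rows A ⟧ → V (col A i)
  row∈⇒col A i = set⁻ (V ∘ col A) {i}

  V-empty : ∀ A → (∀ n → n ∉ ⟦ A ⟧) → ¬ V A
  V-empty A empty A∈V = let n , _ , n∈A = V-cofinal A∈V 0 in empty n n∈A

  𝒰-isUltrafilter : IsUltrafilter 𝒰
  𝒰-isUltrafilter = record
    { univ∈ = 𝒰⁺ (const true) (const true) V-full (λ _ _ → V-full)
    ; empty∉ = λ ∅∈𝒰 → V-empty (rows (const false))
        (λ i i∈ → V-empty (const false) (λ _ ()) (row∈⇒col (const false) i i∈))
        (𝒰⁻ (const false) ∅∈𝒰)
    ; upward = λ A B A⊆B A∈𝒰 → 𝒰⁺ B (rows A) (𝒰⁻ A A∈𝒰) λ i i∈ →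
        V-⊆ (col A i) (col B i) A⊆B (row∈⇒col A i i∈)
    ; ∩-closed = λ A B A∈𝒰 B∈𝒰 →
        𝒰⁺ (λ n → A n ∧ B n) (λ i → rows A i ∧ rows B i)
          (V-∩ (rows A) (rows B) (𝒰⁻ A A∈𝒰) (𝒰⁻ B B∈𝒰)) λ i i∈ →
          V-∩ (col A i) (col B i)
            (row∈⇒col A i (proj₁ (∈-∧⁻ i∈)))
            (row∈⇒col B i (proj₂ (∈-∧⁻ {rows A i} i∈)))
    ; ultra = ultra
    }
    where
    ultra : ∀ A → A ∈ ⟦ 𝒰 ⟧ ⊎ (not ∘ A) ∈ ⟦ 𝒰 ⟧
    ultra A with V-ultra (rows A)
    ... | inj₁ rows∈V = inj₁ (set⁺ (V ∘ rows) {A} rows∈V)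
    -- V-many columns of A are then outside V, so the same columns of the complement are in V.
    ... | inj₂ rows∉V = inj₂ (𝒰⁺ (not ∘ A) (not ∘ rows A) rows∉V λ i i∉ →
      [ (λ col∈V → contradiction (set⁺ (V ∘ col A) {i} col∈V) (∈-not⁻ (rows A i) i∉)) , id ]′
        (V-ultra (col A i)))

  open IsUltrafilter 𝒰-isUltrafilter

  𝒰-column : ∀ {A} → A ∈ ⟦ 𝒰 ⟧ → ∃ λ i → Cofinal ⟦ col A i ⟧
  𝒰-column {A} A∈𝒰 =
    let i , _ , i∈ = V-cofinal {rows A} (𝒰⁻ A A∈𝒰) 0
    in i , V-cofinal {col A i} (row∈⇒col A i i∈)

  𝒰-nonprincipal : ¬ Principal 𝒰
  𝒰-nonprincipal (n , 𝒰≡n) with ultra (set (_≡ n))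
  ... | inj₁ n∈𝒰 =
    let i , cof = 𝒰-column {set (_≡ n)} n∈𝒰
        j , n<j , j∈ = cof (suc n)
    in <⇒≢ (<-≤-trans n<j (j≤enc i j)) (sym (set⁻ (_≡ n) {enc i j} j∈))
  ... | inj₂ n∉𝒰 = ∈-not⁻ _ (Equivalence.to (𝒰≡n (not ∘ set (_≡ n))) n∉𝒰)
      (set⁺ (_≡ n) refl)

  -- Failure of the P-point property, and comparison with 𝔠.

  OffColumn : ℕ → Pred ℕ 0ℓ
  OffColumn n k = ¬ (row k ≡ n)

  offColumn : ℕ → ∃ ⟦ 𝒰 ⟧
  offColumn n = set (OffColumn n) ,
    𝒰⁺ (set (OffColumn n)) (set (λ i → ¬ (i ≡ n))) cofinite∈V λ i i≢n →
      V-⊆ (const true) (col (set (OffColumn n)) i)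
        (λ {j} _ → set⁺ (OffColumn n) {enc i j} λ eq →
        set⁻ (λ i → ¬ (i ≡ n)) {i} i≢n (trans (sym (row-enc i j)) eq)) V-full
    where
    cofinite∈V : V (set (λ i → ¬ (i ≡ n)))
    cofinite∈V = V-upward (const true) (set (λ i → ¬ (i ≡ n)))
      (suc n , λ i n<i _ → set⁺ (λ i → ¬ (i ≡ n)) (<⇒≢ n<i ∘ sym)) V-full

  OffColumns : Pred (∃ ⟦ 𝒰 ⟧) 0ℓ
  OffColumns A = ∃ λ n → A ≡ offColumn n

  -- Any B in 𝒰 has an infinite column i, so it is not almost contained in the complement of column
  -- i.
  offColumns-unbounded : Unbounded ⟨ 𝒰 ,⊇*⟩ ⟦ set OffColumns ⟧
  offColumns-unbounded ((B , B∈𝒰) , bound) with 𝒰-column {B} B∈𝒰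
  ... | i , cof with ⊇*⇒⊆* B (proj₁ (offColumn i))
          (bound (offColumn i) (set⁺ OffColumns (i , refl)))
  ... | N , B⊆ with cof N
  ... | j , N≤j , j∈B = set⁻ (OffColumn i) {enc i j}
          (B⊆ (enc i j) (≤-trans N≤j (j≤enc i j)) j∈B) (row-enc i j)

  𝒰-notPPoint : ¬ IsPPoint 𝒰
  𝒰-notPPoint directed = offColumns-unbounded
    (directed (set OffColumns) (mk↣ {to = number} number-injective))
    where
    number : ∃ ⟦ set OffColumns ⟧ → ℕ
    number (_ , p) = proj₁ (set⁻ OffColumns p)

    number-injective : Injective _≡_ _≡_ number
    number-injective {A , p} {B , q} eq
      with trans (proj₂ (set⁻ OffColumns p))
             (trans (cong offColumn eq) (sym (proj₂ (set⁻ OffColumns q))))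
    ... | refl = cong (A ,_) (T-irrelevant p q)

  -- An unbounded S is cofinal in K. If B is almost contained in every T α × ω with α in S, each
  -- infinite column of B has its index in T α, so `rows B` would be a pseudointersection of the
  -- tower.
  𝔠≤⊇* : Ordinal.quasiorder 𝔠 ≤T ⟨ 𝒰 ,⊇*⟩
  𝔠≤⊇* = f , λ S unbounded ((B , B∈𝒰) , bound) →
    tower-no-pseudointersection {rows B} (V-cofinal {rows B} (𝒰⁻ B B∈𝒰)) λ β →
      let α , α∈S , β≼α = above S unbounded β in
      ⊆*-trans (rows B) (tower α) (tower β)
        (⊆⇒⊆* (rows B) (tower α) (rows⊆ B α (bound (f α) (α , α∈S , refl))))
        (tower-anti β≼α)
    where
    f : K → ∃ ⟦ 𝒰 ⟧
    f α = tower α ∘ row , 𝒰⁺ (tower α ∘ row) (tower α) (V-tower α) λ i i∈T →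
      V-⊆ (const true) (col (tower α ∘ row) i)
        (λ {j} _ → subst (λ i → i ∈ ⟦ tower α ⟧) (sym (row-enc i j)) i∈T) V-full

    above : ∀ S → Unbounded quasiorder ⟦ S ⟧ →
      ∀ β → ∃ λ α → α ∈ ⟦ S ⟧ × β ≼ α
    above S unbounded β = stable λ none → unbounded (β , λ α α∈S →
      stable λ α⋠β → none (α , α∈S , inj₁ (⋠⇒≻ α⋠β)))

    rows⊆ : ∀ B α → proj₁ (f α) ⊇* B → ⟦ rows B ⟧ ⊆ ⟦ tower α ⟧
    rows⊆ B α fα⊇*B {i} i∈ with ⊇*⇒⊆* B (proj₁ (f α)) fα⊇*B
    ... | N , B⊆fα with V-cofinal {col B i} (row∈⇒col B i i∈) N
    ... | j , N≤j , j∈B = subst (λ i → i ∈ ⟦ tower α ⟧) (row-enc i j)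
      (B⊆fα (enc i j) (≤-trans N≤j (j≤enc i j)) j∈B)

  ⊇*≰𝔠 : ¬ (⟨ 𝒰 ,⊇*⟩ ≤T Ordinal.quasiorder 𝔠)
  ⊇*≰𝔠 (f , tukey) = tukey (set OffColumns) offColumns-unbounded
    (let β , le = ℕ-small (f ∘ offColumn) in β , bound β le)
    where
    bound : ∀ β → (∀ n → f (offColumn n) ≼ β) →
      ∀ α → α ∈ image f ⟦ set OffColumns ⟧ → α ≼ β
    bound β le _ (A , A∈ , refl) with set⁻ OffColumns A∈
    ... | n , refl = le n

  ⊇*≤⊇ : ⟨ 𝒰 ,⊇*⟩ ≤T ⟨ 𝒰 ,⊇⟩
  ⊇*≤⊇ = id , λ S unbounded (B , bound) → unbounded (B , λ A A∈S →
    ⊆*⇒⊇* (proj₁ B) (proj₁ A)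
      (⊆⇒⊆* (proj₁ B) (proj₁ A) (bound A (A , A∈S , refl))))

  -- Comparison with the finite subsets of 𝔠.

  singleton : K → Preorder.Carrier ⟨[ K ]^<ω,⊆⟩
  singleton α = set (_≡ α) , α ∷ [] , here ∘ set⁻ (_≡ α)

  -- A finite set bounding the image contains the indices of all members of S, so S is finite and
  -- its intersection lies above some member of 𝒰.
  ⊇≤fin : ⟨ 𝒰 ,⊇⟩ ≤T ⟨[ K ]^<ω,⊆⟩
  ⊇≤fin = singleton ∘ index ∘ proj₁ , λ S unbounded ((σ , αs , σ⊆αs) , bound) →
    let B , B∈𝒰 , B⊆ = ⋂𝒰 αs in
    unbounded ((B , B∈𝒰) , λ (A , A∈𝒰) A∈S {n} n∈B →
      subst (λ A → n ∈ ⟦ A ⟧) (X-index A)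
        (B⊆ (index A)
          (σ⊆αs (bound _ ((A , A∈𝒰) , A∈S , refl) (set⁺ (_≡ index A) refl)))
          (subst (λ A → A ∈ ⟦ 𝒰 ⟧) (sym (X-index A)) A∈𝒰) n∈B))
    where
    -- The list may also contain indices of sets outside 𝒰, which are skipped.
    ⋂𝒰 : (αs : List K) → ∃ λ B → B ∈ ⟦ 𝒰 ⟧ ×
      ∀ α → α List.∈ αs → X α ∈ ⟦ 𝒰 ⟧ → ⟦ B ⟧ ⊆ ⟦ X α ⟧
    ⋂𝒰 [] = const true , univ∈ , λ _ ()
    ⋂𝒰 (α ∷ αs) with ⋂𝒰 αs | T? (𝒰 (X α))
    ... | B , B∈𝒰 , B⊆ | yes Xα∈𝒰 =
      (λ n → X α n ∧ B n) , ∩-closed (X α) B Xα∈𝒰 B∈𝒰 , λ where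
        _ (here refl) _ → proj₁ ∘ ∈-∧⁻
        β (there β∈αs) Xβ∈𝒰 {n} → B⊆ β β∈αs Xβ∈𝒰 ∘ proj₂ ∘ ∈-∧⁻ {X α n}
    ... | B , B∈𝒰 , B⊆ | no Xα∉𝒰 = B , B∈𝒰 , λ where
        _ (here refl) Xα∈𝒰 → contradiction Xα∈𝒰 Xα∉𝒰
        β (there β∈αs) → B⊆ β β∈αs

  -- The set of rows counts as a further column, so that a single diagonalization
  -- controls both levels of V ⊗ V.
  table : 𝒫 ℕ → ℕ → 𝒫 ℕ
  table A zero = rows A
  table A (suc i) = col A i

  -- The n by n corner of t, coded as a vector so that `Vec-small` applies to the approximations.
  prefix : (ℕ → 𝒫 ℕ) → ∀ n → Vec (Vec Bool n) n
  prefix t n = tabulate λ i → tabulate λ x → t (toℕ i) (toℕ x)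

  prefix-≡ : ∀ t t′ n → prefix t n ≡ prefix t′ n →
    ∀ i x → i < n → x < n → t i x ≡ t′ i x
  prefix-≡ t t′ n eq i x i<n x<n =
    trans (sym (entry t)) (trans (cong (λ v → lookup (lookup v i′) x′) eq) (entry t′))
    where
    i′ = fromℕ< i<n
    x′ = fromℕ< x<n

    entry : ∀ t → lookup (lookup (prefix t n) i′) x′ ≡ t i x
    entry t rewrite lookup∘tabulate (λ i → tabulate {n = n} λ x → t (toℕ i) (toℕ x)) i′
                  | lookup∘tabulate (λ x → t (toℕ i′) (toℕ x)) x′
                  | toℕ-fromℕ< i<n | toℕ-fromℕ< x<n = refl

  opaque
    infinite-intersection : (a : K → ∃ ⟦ 𝒰 ⟧) →
      ∃ λ (z : ℕ → K) → Injective _≡_ _≡_ z ×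
      ∃ λ Z → Z ∈ ⟦ 𝒰 ⟧ × ∀ n → ⟦ Z ⟧ ⊆ ⟦ proj₁ (a (z n)) ⟧
    infinite-intersection a
      with condensation (λ n → Vec (Vec Bool n) n)
        (λ n → Vec-small (Vec-small Bool-small n) n)
        (λ n y → prefix (table (proj₁ (a y))) n)
    ... | x , dense = z , z-injective , Z , Z∈𝒰 , λ n → Z⊆ n
      where
      y : ℕ → K
      y zero = x
      -- An index above `y k` whose table agrees with that of x on the corner of size k + 1.
      y (suc k) = proj₁ (dense (suc k) (y k))

      A : ℕ → 𝒫 ℕ
      A k = proj₁ (a (y k))

      C : ℕ → ℕ → 𝒫 ℕ
      C k = table (A k)

      L : ℕ → 𝒫 ℕ
      L = table (proj₁ (a x))

      agree : ∀ k i j → i < k → j < k → C k i j ≡ L i j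
      agree zero i j ()
      agree (suc k) i j = prefix-≡ (C (suc k)) L (suc k)
        (proj₂ (proj₂ (dense (suc k) (y k)))) i j

      y-mono : ∀ {k l} → k < l → y k ≺ y l
      y-mono {k} {suc l} (s≤s k≤l) with m≤n⇒m<n∨m≡n k≤l
      ... | inj₁ k<l = ≺-trans (y-mono k<l) (proj₁ (proj₂ (dense (suc l) (y l))))
      ... | inj₂ refl = proj₁ (proj₂ (dense (suc l) (y l)))

      ≺⇒≢ : ∀ {α β} → α ≺ β → ¬ (α ≡ β)
      ≺⇒≢ α≺β α≡β = IsStrictTotalOrder.irrefl isStrictTotalOrder α≡β α≺β

      y-injective : Injective _≡_ _≡_ y
      y-injective {k} {l} eq with <-cmp k l
      ... | tri< k<l _ _ = contradiction eq (≺⇒≢ (y-mono k<l))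
      ... | tri≈ _ k≡l _ = k≡l
      ... | tri> _ _ l<k = contradiction (sym eq) (≺⇒≢ (y-mono l<k))

      D : ℕ → 𝒫 ℕ
      D i = proj₁ (V-pseudointersection λ k → C k i)

      D∈V : ∀ i → V (D i)
      D∈V i = proj₁ (proj₂ (V-pseudointersection λ k → C k i))

      almost : ∀ i k → V (C k i) → D i ⊆* C k i
      almost i = proj₂ (proj₂ (V-pseudointersection λ k → C k i))

      subsequence : Subsequence C L D agree almost
      subsequence = diagonal-subsequence C L D agree almost

      e : ℕ → ℕ
      e = proj₁ subsequence

      Y : 𝒫 ℕ
      Y = proj₁ (proj₂ (proj₂ subsequence))

      Y∈V : V Y
      Y∈V = proj₁ (proj₂ (proj₂ (proj₂ subsequence)))

      z : ℕ → K
      z = y ∘ e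

      z-injective : Injective _≡_ _≡_ z
      z-injective = proj₁ (proj₂ subsequence) ∘ y-injective

      core : ℕ → 𝒫 ℕ
      core i j = Y j ∧ (L i j ∧ D i j)

      core∈V : ∀ i → V (L i) → V (core i)
      core∈V i Li∈V = V-∩ Y _ Y∈V (V-∩ (L i) (D i) Li∈V (D∈V i))

      core⊆ : ∀ i n → i ≤ n → V (C (e n) i) → ⟦ core i ⟧ ⊆ ⟦ C (e n) i ⟧
      core⊆ i n i≤n Ceni∈V {j} j∈ =
        let j∈Y , j∈LD = ∈-∧⁻ {Y j} j∈
            j∈L , j∈D = ∈-∧⁻ {L i j} j∈LD
        in proj₂ (proj₂ (proj₂ (proj₂ subsequence))) i n i≤n Ceni∈V j j∈Y j∈L j∈D

      rows∈V : ∀ k → V (C k 0)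
      rows∈V k = 𝒰⁻ (A k) (proj₂ (a (y k)))

      -- The set of rows has table index 0, and 0 ≤ n always holds, so `core 0` lies in the rows of
      -- every member of the subsequence.
      common-row : ∀ {i} → i ∈ ⟦ core 0 ⟧ → ∀ n → V (C (e n) (suc i))
      common-row {i} i∈ n = row∈⇒col (A (e n)) i (core⊆ 0 n z≤n (rows∈V (e n)) i∈)

      limit-row : ∀ {i} → i ∈ ⟦ core 0 ⟧ → V (L (suc i))
      limit-row {i} i∈ =
        row∈⇒col (proj₁ (a x)) i (proj₁ (∈-∧⁻ {L 0 i} (proj₂ (∈-∧⁻ {Y i} i∈))))

      initial : (F : ℕ → 𝒫 ℕ) → (∀ n → V (F n)) → ∀ N →
        ∃ λ I → V I × ∀ n → n < N → ⟦ I ⟧ ⊆ ⟦ F n ⟧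
      initial F F∈V zero = const true , V-full , λ _ ()
      initial F F∈V (suc N) with initial F F∈V N
      ... | I , I∈V , I⊆ = (λ j → F N j ∧ I j) , V-∩ (F N) I (F∈V N) I∈V , within
        where
        within : ∀ n → n < suc N → ⟦ (λ j → F N j ∧ I j) ⟧ ⊆ ⟦ F n ⟧
        within n (s≤s n≤N) {j} j∈ with m≤n⇒m<n∨m≡n n≤N
        ... | inj₁ n<N = I⊆ n n<N (proj₂ (∈-∧⁻ {F N j} j∈))
        ... | inj₂ refl = proj₁ (∈-∧⁻ j∈)

      Common : Pred ℕ 0ℓ
      Common k = ∀ n → k ∈ ⟦ A (e n) ⟧

      Z : 𝒫 ℕ
      Z = set Common

      Z⊆ : ∀ n → ⟦ Z ⟧ ⊆ ⟦ A (e n) ⟧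
      Z⊆ n k∈Z = set⁻ Common k∈Z n

      Z∈𝒰 : Z ∈ ⟦ 𝒰 ⟧
      -- For i in `core 0`, the set `core (suc i)` lies in column i of every member with n > i, and
      -- I takes care of the finitely many n ≤ i.
      Z∈𝒰 = 𝒰⁺ Z (core 0) (core∈V 0 (𝒰⁻ (proj₁ (a x)) (proj₂ (a x)))) λ i i∈ →
        let I , I∈V , I⊆ = initial (λ n → C (e n) (suc i)) (common-row i∈) (suc i)
        in V-⊆ (λ j → core (suc i) j ∧ I j) (col Z i)
          (λ {j} j∈ → set⁺ Common {enc i j} λ n →
            let j∈core , j∈I = ∈-∧⁻ {core (suc i) j} j∈ in
            [ (λ n≤i → I⊆ n (s≤s n≤i) j∈I)
            , (λ i<n → core⊆ (suc i) n i<n (common-row i∈ n) j∈core)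
            ]′ (≤-<-connex n i))
          (V-∩ (core (suc i)) I (core∈V (suc i) (limit-row i∈)) I∈V)

  -- By injectivity each entry of the list is hit at most once.
  injective-sequence-leaves-list : (z : ℕ → K) → Injective _≡_ _≡_ z →
    (αs : List K) → ∃ λ N → ∀ n → N ≤ n → ¬ (z n List.∈ αs)
  injective-sequence-leaves-list z z-inj [] = 0 , λ _ _ ()
  injective-sequence-leaves-list z z-inj (α ∷ αs)
    with injective-sequence-leaves-list z z-inj αs | em {∃ λ n → z n ≡ α}
  ... | N , leaves | no α∉z = N , λ where
    n N≤n (here eq) → α∉z (n , eq)
    n N≤n (there zn∈αs) → leaves n N≤n zn∈αs
  ... | N , leaves | yes (M , zM≡α) = suc M ⊔ N , λ where
    n le (here eq) →
      <⇒≢ (m⊔n≤o⇒m≤o (suc M) N le) (z-inj (trans zM≡α (sym eq)))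
    n le (there zn∈αs) → leaves n (m⊔n≤o⇒n≤o (suc M) N le) zn∈αs

  -- Among the images of the singletons, infinitely many indices share one lower set Z in 𝒰, which
  -- bounds their images. The corresponding singletons are distinct and have no finite upper bound.
  fin≰⊇ : ¬ (⟨[ K ]^<ω,⊆⟩ ≤T ⟨ 𝒰 ,⊇⟩)
  fin≰⊇ (f , tukey) with infinite-intersection (f ∘ singleton)
  ... | z , z-inj , Z , Z∈𝒰 , Z⊆ =
    tukey (set Singletons) unbounded ((Z , Z∈𝒰) , bound)
    where
    Singletons : Pred (Preorder.Carrier ⟨[ K ]^<ω,⊆⟩) 0ℓ
    Singletons σ = ∃ λ n → σ ≡ singleton (z n)

    unbounded : Unbounded ⟨[ K ]^<ω,⊆⟩ ⟦ set Singletons ⟧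
    unbounded ((τ , αs , τ⊆αs) , upper) =
      let N , leaves = injective-sequence-leaves-list z z-inj αs in
      leaves N ≤-refl (τ⊆αs (upper (singleton (z N))
        (set⁺ Singletons (N , refl)) (set⁺ (_≡ z N) refl)))

    bound : ∀ A → A ∈ image f ⟦ set Singletons ⟧ → ⟦ Z ⟧ ⊆ ⟦ proj₁ A ⟧
    bound _ (σ , σ∈ , refl) with set⁻ Singletons σ∈
    ... | n , refl = Z⊆ n

theorem3p11 : ExcludedMiddle 0ℓ → Extensionality 0ℓ 0ℓ →
    (𝔠 : Ordinal) → IsContinuum 𝔠 →
    ◇ 𝔠 (E 𝔠 ℕ) →
    𝔭≡ (Ordinal.Carrier 𝔠) →
    ∃ λ 𝒰 →
    IsUltrafilter 𝒰 × ¬ Principal 𝒰 × ¬ IsPPoint 𝒰 ×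
    (Ordinal.quasiorder 𝔠 <T ⟨ 𝒰 ,⊇*⟩) ×
    (⟨ 𝒰 ,⊇*⟩ ≤T ⟨ 𝒰 ,⊇⟩) ×
    (⟨ 𝒰 ,⊇⟩ <T ⟨[ Ordinal.Carrier 𝔠 ]^<ω,⊆⟩)
theorem3p11 em ext 𝔠 continuum _ 𝔭≡𝔠 =
  𝒰 em ext 𝔠 continuum 𝔭≡𝔠 ,
  𝒰-isUltrafilter em ext 𝔠 continuum 𝔭≡𝔠 ,
  𝒰-nonprincipal em ext 𝔠 continuum 𝔭≡𝔠 ,
  𝒰-notPPoint em ext 𝔠 continuum 𝔭≡𝔠 ,
  (𝔠≤⊇* em ext 𝔠 continuum 𝔭≡𝔠 , ⊇*≰𝔠 em ext 𝔠 continuum 𝔭≡𝔠) ,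
  ⊇*≤⊇ em ext 𝔠 continuum 𝔭≡𝔠 ,
  (⊇≤fin em ext 𝔠 continuum 𝔭≡𝔠 , fin≰⊇ em ext 𝔠 continuum 𝔭≡𝔠)
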